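{- For any finite set $D$ and any function $f\colon D\times D\to D$ there is a cyclic partition $\mathcal{P}$ of $f$ such that $\mathrm{cost}(\mathcal{P})\le\frac34|D|^2$ when $|D|$ is even, and $\mathrm{cost}(\mathcal{P})\le\frac34|D|^2+\frac14|D|$ when $|D|$ is odd.
   Context: For $k\in\mathbb{N}$ let $\mathbb{Z}_k=\{0,1,\ldots,k-1\}$. A function $f\colon A\times B\to C$ is $k$-cyclic if there are functions $\sigma_A\colon A\to\mathbb{Z}_k$, $\sigma_B\colon B\to\mathbb{Z}_k$ and $\sigma_C\colon\mathbb{Z}_k\to C$ such that $f(a,b)=\sigma_C(\sigma_A(a)+\sigma_B(b)\bmod k)$ for all $a\in A$, $b\in B$. For $f\colon D\times D\to D$, a triple $(A,B,k)$ with $A,B\subseteq D$, $k\in\mathbb{N}$, is a cyclic minor of $f$ if the restriction of $f$ to $A\times B$ is $k$-cyclic. A cyclic partition of $f$ is a set $\mathcal{P}=\{(A_1,B_1,k_1),\ldots,(A_m,B_m,k_m)\}$ of cyclic minors of $f$ such that for every $(a,b)\in D\times D$ there is a unique $i\in\{1,\ldots,m\}$ with $(a,b)\in A_i\times B_i$. Its cost is $\mathrm{cost}(\mathcal{P})=\sum_{i=1}^m k_i$. -}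

module Defs where

open import Data.Fin.Base using (Fin; toℕ)
open import Data.Nat.Base using (ℕ; _+_; NonZero)
open import Data.Nat.DivMod using (_mod_)
open import Data.Nat.Properties using (+-0-commutativeMonoid)
open import Data.Product using (Σ; Σ-syntax; ∃!; _×_; proj₁)
open import Level using (Level; 0ℓ; _⊔_) renaming (suc to lsuc)
open import Relation.Binary.PropositionalEquality.Core using (_≡_)
open import Relation.Unary using (Pred; Decidable; _∈_; _≐_)

open import Algebra.Properties.CommutativeMonoid.Sum +-0-commutativeMonoid using (sum)

private
  variable
    a b c ℓ : Level

-- ℤ_k is Fin k.  Reduction mod k only makes sense for k ≥ 1, so k = 0 is
-- excluded.  (A 0-cyclic function could only have A and B both empty, as ℤ_0
-- is empty, and would contribute neither coverage nor cost to a partition.)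

IsCyclic : {A : Set a} {B : Set b} {C : Set c}
           (k : ℕ) → .{{NonZero k}} → (A → B → C) → Set (a ⊔ b ⊔ c)
IsCyclic {A = A} {B} {C} k f =
  Σ[ σA ∈ (A → Fin k) ] Σ[ σB ∈ (B → Fin k) ] Σ[ σC ∈ (Fin k → C) ]
    ((x : A) (y : B) → f x y ≡ σC ((toℕ (σA x) + toℕ (σB y)) mod k))

restrict : {D : Set ℓ} → (D → D → D) →
           (A B : Pred D 0ℓ) → Σ D A → Σ D B → D
restrict f A B x y = f (proj₁ x) (proj₁ y)

-- Subsets of D are decidable predicates, which for finite D matches the
-- classical notion of subset.

record CyclicMinor {D : Set ℓ} (f : D → D → D) : Set (ℓ ⊔ lsuc 0ℓ) where
  field
    A B         : Pred D 0ℓ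
    A?          : Decidable A
    B?          : Decidable B
    k           : ℕ
    {{nonZero}} : NonZero k
    cyclic      : IsCyclic k (restrict f A B)

open CyclicMinor

-- Equality of the underlying triples (A , B , k): subsets are compared
-- extensionally, and the witnesses of cyclicity are disregarded.

SameTriple : {D : Set ℓ} {f : D → D → D} → CyclicMinor f → CyclicMinor f → Set ℓ
SameTriple M N = A M ≐ A N × B M ≐ B N × k M ≡ k N

-- The set {(A₁,B₁,k₁), …, (Aₘ,Bₘ,kₘ)} is an enumeration without repetition,
-- so that summing over the index set agrees with summing over the set.

record CyclicPartition {D : Set ℓ} (f : D → D → D) : Set (ℓ ⊔ lsuc 0ℓ) where
  field
    m         : ℕ
    minor     : Fin m → CyclicMinor f
    distinct  : ∀ i j → SameTriple (minor i) (minor j) → i ≡ j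
    partition : ∀ x y → ∃! _≡_ λ i → x ∈ A (minor i) × y ∈ B (minor i)

cost : {D : Set ℓ} {f : D → D → D} → CyclicPartition f → ℕ
cost P = sum λ i → k (minor i)
  where open CyclicPartition P

{-# OPTIONS --safe #-}
-- Split D into pairs of rows, with one row left over when |D| is odd.  For a
-- pair of rows x, y read each column c as an edge from f x c to f y c of a
-- directed graph on D.  A trail of l columns is (l + 1)-cyclic on {x, y}, and a
-- closed trail is l-cyclic: give row x the label 0, row y the label 1, and each
-- column its position on the trail.  Start from the n single columns (cost 2n)
-- and join end to start as long as possible, each joining lowering the cost by
-- one.  If J lists the vertices of the joinings, the cost becomes 2n - |J|, and
-- every value occurring in both rows lies in J.  Cutting each row into the sets
-- on which it is constant costs the number of distinct values per row, in total
-- at most n + |J|.  The better of the two costs at most 3n/2.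
module Submission where

open import Data.Fin.Base using (Fin; zero; suc; toℕ)
open import Data.Fin.Properties using (_≟_; any?; toℕ<n; toℕ-fromℕ<)
open import Data.List.Base using (List; []; _∷_; _++_; map; filter; length; lookup; allFin)
import Data.List.Membership.DecPropositional as DecMembership
open import Data.List.Membership.Propositional using (_∈_; find; lose)
open import Data.List.Membership.Propositional.Properties
  using (∈-∃++; ∈-allFin; ∈-lookup; ∈-length; ∈-filter⁺; ∈-filter⁻; ∈-++⁺ˡ; ∈-++⁺ʳ; ∈-++⁻)
open import Data.List.Properties using (length-++; length-filter; length-tabulate; map-++; map-∘)
open import Data.List.Relation.Binary.Disjoint.Propositional using (Disjoint)
open import Data.List.Relation.Binary.Permutation.Propositional using (_↭_; ↭-trans; prep; ↭⇒↭ₛ)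
open import Data.List.Relation.Binary.Permutation.Propositional.Properties
  using (shift; Any-resp-↭; ↭-length; map⁺)
import Data.List.Relation.Binary.Permutation.Setoid.Properties as Permutationₛ
open import Data.List.Relation.Binary.Subset.Propositional using (_⊆_)
open import Data.List.Relation.Unary.All as All using (All; []; _∷_)
import Data.List.Relation.Unary.All.Properties as All
open import Data.List.Relation.Unary.AllPairs as AllPairs using (AllPairs; []; _∷_)
import Data.List.Relation.Unary.AllPairs.Properties as AllPairs
open import Data.List.Relation.Unary.Any as Any using (Any; here; there; index)
import Data.List.Relation.Unary.Any.Properties as Any
open import Data.List.Relation.Unary.Unique.Propositional using (Unique)
import Data.List.Relation.Unary.Unique.Propositional.Properties as Unique
open import Data.Nat.Base using (ℕ; zero; suc; _+_; _*_; _^_; _≤_; z≤n; s≤s; NonZero; >-nonZero)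
open import Data.Nat.Divisibility using (_∣_; _∤_; ∣m+n∣m⇒∣n; ∣m∣n⇒∣m+n; ∣-refl; ∣1⇒≡1)
open import Data.Nat.DivMod using (_%_; _mod_; m%n<n; m<n⇒m%n≡m; n%n≡0; %-distribˡ-+)
open import Data.Nat.ListAction using (sum)
open import Data.Nat.ListAction.Properties using (sum-++; sum-↭)
open import Data.Nat.Properties hiding (_≟_)
open import Data.Nat.Tactic.RingSolver using (solve-∀)
open import Data.Product using (Σ; ∃; ∃₂; _×_; _,_; proj₁; proj₂)
open import Data.Sum using (_⊎_; inj₁; inj₂; [_,_]′)
open import Function.Base using (_∘_; id)
open import Function.Bundles using (_↔_; Inverse)
open import Level using (Level; 0ℓ)
open import Relation.Binary.Core using (Rel)
open import Relation.Binary.Definitions using (Symmetric)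
open import Relation.Binary.PropositionalEquality
  using (_≡_; _≢_; refl; sym; trans; cong; cong₂; subst; resp₂; setoid; module ≡-Reasoning)
open import Relation.Nullary using (¬_; Dec; yes; no; contradiction; _×-dec_; _⊎-dec_)
open import Relation.Unary using (Pred; Decidable; Satisfiable; _∪_)
open import Algebra.Properties.CommutativeMonoid.Sum +-0-commutativeMonoid
  using () renaming (sum to ∑)
open import Defs

open CyclicMinor using (A; B; A?; B?; k)

private
  variable
    a p q r : Level
    X : Set a

-- Lists

∈⇒↭∷ : {x : X} {xs : List X} → x ∈ xs → ∃ λ ys → xs ↭ x ∷ ys
∈⇒↭∷ x∈xs with ys , zs , refl ← ∈-∃++ x∈xs = ys ++ zs , shift _ ys zs

AllPairs-resp-↭ : {R : Rel X r} → Symmetric R → {xs ys : List X} →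
                  xs ↭ ys → AllPairs R xs → AllPairs R ys
AllPairs-resp-↭ {R = R} R-sym xs↭ys =
  Permutationₛ.AllPairs-resp-↭ (setoid _) R-sym (resp₂ R) (↭⇒↭ₛ xs↭ys)

AllPairs-lookup : {R : Rel X r} → Symmetric R → {xs : List X} → AllPairs R xs →
                  ∀ i j → i ≢ j → R (lookup xs i) (lookup xs j)
AllPairs-lookup R-sym (_  ∷ _)  zero    zero    i≢j = contradiction refl i≢j
AllPairs-lookup R-sym (Rx ∷ _)  zero    (suc j) _   = All.lookup Rx (∈-lookup j)
AllPairs-lookup R-sym (Rx ∷ _)  (suc i) zero    _   = R-sym (All.lookup Rx (∈-lookup i))
AllPairs-lookup R-sym (_  ∷ Rs) (suc i) (suc j) i≢j =
  AllPairs-lookup R-sym Rs i j (i≢j ∘ cong suc)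

-- Each element of `xs` takes one occurrence out of `ys`; as `xs` has no repetition, its tail stays
-- inside what remains. It serves to bound the number of distinct vertices in a list `J` that may
-- contain repetitions.
unique-⊆⇒length≤ : {xs ys : List X} → Unique xs → xs ⊆ ys → length xs ≤ length ys
unique-⊆⇒length≤ []                 _     = z≤n
unique-⊆⇒length≤ {xs = x ∷ xs} (x∉xs ∷ xs!) xs⊆ys
  with zs , ys↭ ← ∈⇒↭∷ (xs⊆ys (here refl)) =
  ≤-trans (s≤s (unique-⊆⇒length≤ xs! xs⊆zs)) (≤-reflexive (sym (↭-length ys↭)))
  where
  xs⊆zs : xs ⊆ zs
  xs⊆zs z∈xs with Any-resp-↭ ys↭ (xs⊆ys (there z∈xs))
  ... | here z≡x    = contradiction (sym z≡x) (All.lookup x∉xs z∈xs)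
  ... | there z∈zs = z∈zs

module _ {P : Pred X p} {Q : Pred X q} {R : Pred X r}
         (P? : Decidable P) (Q? : Decidable Q) (R? : Decidable R)
         (P∩Q⇒R : ∀ {x} → P x → Q x → R x) where

  -- Inclusion-exclusion: the union of `P` and `Q` is bounded by the whole list, their intersection
  -- by `R`.
  length-filter-+ : ∀ xs → length (filter P? xs) + length (filter Q? xs) ≤
                           length xs + length (filter R? xs)
  length-filter-+ []       = z≤n
  length-filter-+ (x ∷ xs) with length-filter-+ xs | P? x | Q? x | R? x
  ... | ih | yes Px | yes Qx | no ¬Rx = contradiction (P∩Q⇒R Px Qx) ¬Rx
  ... | ih | yes _  | yes _  | yes _  = s≤s (≤-trans (≤-reflexive (+-suc _ _))
                                          (≤-trans (s≤s ih) (≤-reflexive (sym (+-suc _ _)))))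
  ... | ih | yes _  | no _   | yes _  = s≤s (≤-trans ih (+-monoʳ-≤ (length xs) (n≤1+n _)))
  ... | ih | yes _  | no _   | no _   = s≤s ih
  ... | ih | no _   | yes _  | yes _  = ≤-trans (≤-reflexive (+-suc _ _))
                                          (s≤s (≤-trans ih (+-monoʳ-≤ (length xs) (n≤1+n _))))
  ... | ih | no _   | yes _  | no _   = ≤-trans (≤-reflexive (+-suc _ _)) (s≤s ih)
  ... | ih | no _   | no _   | yes _  = ≤-trans ih (+-mono-≤ (n≤1+n _) (n≤1+n _))
  ... | ih | no _   | no _   | no _   = m≤n⇒m≤1+n ih

sum-map-const : (f : X → ℕ) {c : ℕ} → (∀ x → f x ≡ c) → ∀ xs → sum (map f xs) ≡ length xs * c
sum-map-const f f≡c []       = refl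
sum-map-const f f≡c (x ∷ xs) = cong₂ _+_ (f≡c x) (sum-map-const f f≡c xs)

∑-lookup : (f : X → ℕ) (xs : List X) → ∑ (λ i → f (lookup xs i)) ≡ sum (map f xs)
∑-lookup f []       = refl
∑-lookup f (x ∷ xs) = cong (f x +_) (∑-lookup f xs)

-- Trails

module Trails {n : ℕ} (src tgt : Fin n → Fin n) where

  infixr 5 _▸_

  data Trail : Fin n → List (Fin n) → Fin n → Set where
    stop : ∀ {u} → Trail u [] u
    _▸_  : ∀ e {es v} → Trail (tgt e) es v → Trail (src e) (e ∷ es) v

  join : ∀ {u v w es fs} → Trail u es v → Trail v fs w → Trail u (es ++ fs) w
  join stop    t = t
  join (e ▸ s) t = e ▸ join s t

  -- Junk value: past the end of the trail, vertex stays at its final vertex.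
  vertex : List (Fin n) → Fin n → ℕ → Fin n
  vertex []       v _       = v
  vertex (e ∷ es) v zero    = src e
  vertex (e ∷ es) v (suc i) = vertex es v i

  vertex-start : ∀ {u es v} → Trail u es v → vertex es v 0 ≡ u
  vertex-start stop    = refl
  vertex-start (e ▸ t) = refl

  vertex-end : ∀ es v → vertex es v (length es) ≡ v
  vertex-end []       v = refl
  vertex-end (e ∷ es) v = vertex-end es v

  -- With `tgt-vertex` this is the source of cyclicity: the edge at position i runs from vertex i to
  -- vertex i + 1, so a value depends only on row label plus position. The position is read off the
  -- membership proof.
  src-vertex : ∀ {u es v e} → Trail u es v → (e∈ : e ∈ es) →
               src e ≡ vertex es v (toℕ (index e∈))
  src-vertex (e ▸ t) (here refl) = refl
  src-vertex (e ▸ t) (there e∈)  = src-vertex t e∈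

  tgt-vertex : ∀ {u es v e} → Trail u es v → (e∈ : e ∈ es) →
               tgt e ≡ vertex es v (suc (toℕ (index e∈)))
  tgt-vertex (e ▸ t) (here refl) = sym (vertex-start t)
  tgt-vertex (e ▸ t) (there e∈)  = tgt-vertex t e∈

  -- A trail whose two ends coincide may still be an open piece, waiting to be
  -- closed.

  data Shape (u v : Fin n) : Set where
    open-trail   : Shape u v
    closed-trail : u ≡ v → Shape u v

  data IsOpen {u v : Fin n} : Shape u v → Set where
    open-trail : IsOpen open-trail

  isOpen? : ∀ {u v} (s : Shape u v) → Dec (IsOpen s)
  isOpen? open-trail       = yes open-trail
  isOpen? (closed-trail _) = no λ ()

  -- The field `nonempty` makes the weight of a closed piece positive, and later ensures that every
  -- tile contains a cell.
  record Piece : Set where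
    field
      {start end} : Fin n
      {edges}     : List (Fin n)
      trail       : Trail start edges end
      nonempty    : ∃ (_∈ edges)
      shape       : Shape start end

  open Piece public

  -- The modulus of the resulting cyclic minor: an open trail of l edges uses the positions 0 to l,
  -- and closing it identifies l with 0.
  weight : Piece → ℕ
  weight P with shape P
  ... | open-trail     = suc (length (edges P))
  ... | closed-trail _ = length (edges P)

  -- Decompositions of the columns into pieces

  EdgeDisjoint : Rel Piece 0ℓ
  EdgeDisjoint P Q = Disjoint (edges P) (edges Q)

  StartsAt EndsAt : Fin n → Piece → Set
  StartsAt v P = IsOpen (shape P) × v ≡ start P
  EndsAt   v P = IsOpen (shape P) × v ≡ end P

  -- `P` and `Q` may be the same piece; joining it to itself means closing it.
  Joinable : Piece → Piece → Set
  Joinable P Q = IsOpen (shape P) × StartsAt (end P) Q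

  joinable? : ∀ P Q → Dec (Joinable P Q)
  joinable? P Q = isOpen? (shape P) ×-dec isOpen? (shape Q) ×-dec end P ≟ start Q

  Saturated : List Piece → Set
  Saturated ps = ¬ Any (λ P → Any (Joinable P) ps) ps

  -- `J` collects, with repetition, the vertices at which joinings took place. A source is either in
  -- `J` or still the free start of an open piece, and likewise for targets. The sum in `balance` is
  -- invariant, since a joining adds one entry to `J` and takes one from the weight.
  record Decomposition (ps : List Piece) (J : List (Fin n)) : Set where
    field
      disjoint : AllPairs EdgeDisjoint ps
      covering : ∀ e → Any (λ P → e ∈ edges P) ps
      sources  : ∀ e → src e ∈ J ⊎ Any (StartsAt (src e)) ps
      targets  : ∀ e → tgt e ∈ J ⊎ Any (EndsAt (tgt e)) ps
      balance  : length J + sum (map weight ps) ≡ n + n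

  open Decomposition public

  Decomposition-resp-↭ : ∀ {ps qs J} → ps ↭ qs → Decomposition ps J → Decomposition qs J
  Decomposition-resp-↭ {J = J} ps↭qs d = record
    { disjoint = AllPairs-resp-↭ {R = EdgeDisjoint} (λ dis (e∈P , e∈Q) → dis (e∈Q , e∈P))
                                 ps↭qs (disjoint d)
    ; covering = Any-resp-↭ ps↭qs ∘ covering d
    ; sources  = [ inj₁ , inj₂ ∘ Any-resp-↭ ps↭qs ]′ ∘ sources d
    ; targets  = [ inj₁ , inj₂ ∘ Any-resp-↭ ps↭qs ]′ ∘ targets d
    ; balance  = trans (cong (length J +_) (sym (sum-↭ (map⁺ weight ps↭qs)))) (balance d)
    }

  single : Fin n → Piece
  single e = record { trail = e ▸ stop ; nonempty = e , here refl ; shape = open-trail }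

  singles : Decomposition (map single (allFin n)) []
  singles = record
    { disjoint = AllPairs.map⁺ (AllPairs.map (λ { e≢f (here refl , here refl) → e≢f refl })
                                             (Unique.allFin⁺ n))
    ; covering = λ e → Any.map⁺ (lose (∈-allFin e) (here refl))
    ; sources  = λ e → inj₂ (Any.map⁺ (lose (∈-allFin e) (open-trail , refl)))
    ; targets  = λ e → inj₂ (Any.map⁺ (lose (∈-allFin e) (open-trail , refl)))
    ; balance  = begin
        sum (map weight (map single (allFin n))) ≡⟨ cong sum (map-∘ (allFin n)) ⟨
        sum (map (weight ∘ single) (allFin n))   ≡⟨ sum-map-const _ (λ _ → refl) (allFin n) ⟩
        length (allFin n) * 2                    ≡⟨ cong (_* 2) (length-tabulate {n = n} id) ⟩
        n * 2                                    ≡⟨ double n ⟩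
        n + n                                    ∎
    }
    where
    open ≡-Reasoning
    double : ∀ m → m * 2 ≡ m + m
    double = solve-∀

  -- The only free start and free end that disappear are those of `P`, both at the vertex added to
  -- `J`. The weight drops from l + 1 to l.
  closeHead : ∀ {P ps J} → Joinable P P → Decomposition (P ∷ ps) J →
              ∃ λ P′ → Decomposition (P′ ∷ ps) (start P ∷ J)
  closeHead {P@record { shape = open-trail }} {ps} {J} (_ , _ , end≡start) d = P′ , record
    { disjoint = AllPairs-head (disjoint d)
    ; covering = λ e → Any-head (covering d e)
    ; sources  = λ e → source (sources d e)
    ; targets  = λ e → target (targets d e)
    ; balance  = trans (sym (+-suc (length J) _)) (balance d)
    }
    where
    P′ : Piece
    P′ = record { trail = trail P ; nonempty = nonempty P ; shape = closed-trail (sym end≡start) }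

    AllPairs-head : AllPairs EdgeDisjoint (P ∷ ps) →
                    AllPairs EdgeDisjoint (P′ ∷ ps)
    AllPairs-head (dis ∷ diss) = dis ∷ diss

    Any-head : ∀ {e} → Any (λ P → e ∈ edges P) (P ∷ ps) → Any (λ P → e ∈ edges P) (P′ ∷ ps)
    Any-head (here e∈)  = here e∈
    Any-head (there e∈) = there e∈

    source : ∀ {v} → v ∈ J ⊎ Any (StartsAt v) (P ∷ ps) →
             v ∈ start P ∷ J ⊎ Any (StartsAt v) (P′ ∷ ps)
    source (inj₁ v∈J)             = inj₁ (there v∈J)
    source (inj₂ (here (_ , v≡))) = inj₁ (here v≡)
    source (inj₂ (there s))       = inj₂ (there s)

    target : ∀ {v} → v ∈ J ⊎ Any (EndsAt v) (P ∷ ps) →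
             v ∈ start P ∷ J ⊎ Any (EndsAt v) (P′ ∷ ps)
    target (inj₁ v∈J)             = inj₁ (there v∈J)
    target (inj₂ (here (_ , v≡))) = inj₁ (here (trans v≡ end≡start))
    target (inj₂ (there s))       = inj₂ (there s)

  -- The end of `P` and the start of `Q` disappear at the vertex added to `J`, while the start of
  -- `P` and the end of `Q` survive. Weights l + 1 and m + 1 become l + m + 1. The result stays open
  -- even if its ends coincide; closing it is a further joining.
  joinHeads : ∀ {P Q ps J} → Joinable P Q → Decomposition (P ∷ Q ∷ ps) J →
              ∃ λ P′ → Decomposition (P′ ∷ ps) (start Q ∷ J)
  joinHeads {P@record { shape = open-trail }} {Q@record { shape = open-trail }} {ps} {J}
            (_ , _ , end≡start) d = PQ , record
    { disjoint = join-disjoint (disjoint d)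
    ; covering = λ e → join-covering (covering d e)
    ; sources  = λ e → source (sources d e)
    ; targets  = λ e → target (targets d e)
    ; balance  = trans
        (cong (λ l → suc (length J + (suc l + sum (map weight ps)))) (length-++ (edges P)))
        (trans (regroup (length J) (length (edges P)) (length (edges Q)) _) (balance d))
    }
    where
    PQ : Piece
    PQ = record
      { trail    = join (subst (Trail (start P) (edges P)) end≡start (trail P)) (trail Q)
      ; nonempty = proj₁ (nonempty P) , ∈-++⁺ˡ (proj₂ (nonempty P))
      ; shape    = open-trail
      }

    regroup : ∀ j l m s → suc (j + (suc (l + m) + s)) ≡ j + (suc l + (suc m + s))
    regroup = solve-∀

    join-disjoint : AllPairs EdgeDisjoint (P ∷ Q ∷ ps) →
                    AllPairs EdgeDisjoint (PQ ∷ ps)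
    join-disjoint ((_ ∷ disP) ∷ disQ ∷ diss) =
      All.zipWith {R = EdgeDisjoint PQ}
                  (λ (dP , dQ) (e∈PQ , e∈R) →
                    [ (λ e∈P → dP (e∈P , e∈R)) , (λ e∈Q → dQ (e∈Q , e∈R)) ]′
                    (∈-++⁻ (edges P) e∈PQ))
                  (disP , disQ)
      ∷ diss

    join-covering : ∀ {e} → Any (λ P → e ∈ edges P) (P ∷ Q ∷ ps) →
                    Any (λ P → e ∈ edges P) (PQ ∷ ps)
    join-covering (here e∈P)         = here (∈-++⁺ˡ e∈P)
    join-covering (there (here e∈Q)) = here (∈-++⁺ʳ (edges P) e∈Q)
    join-covering (there (there e∈)) = there e∈

    source : ∀ {v} → v ∈ J ⊎ Any (StartsAt v) (P ∷ Q ∷ ps) →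
             v ∈ start Q ∷ J ⊎ Any (StartsAt v) (PQ ∷ ps)
    source (inj₁ v∈J)                     = inj₁ (there v∈J)
    source (inj₂ (here (_ , v≡)))         = inj₂ (here (open-trail , v≡))
    source (inj₂ (there (here (_ , v≡)))) = inj₁ (here v≡)
    source (inj₂ (there (there s)))       = inj₂ (there s)

    target : ∀ {v} → v ∈ J ⊎ Any (EndsAt v) (P ∷ Q ∷ ps) →
             v ∈ start Q ∷ J ⊎ Any (EndsAt v) (PQ ∷ ps)
    target (inj₁ v∈J)                     = inj₁ (there v∈J)
    target (inj₂ (here (_ , v≡)))         = inj₁ (here (trans v≡ end≡start))
    target (inj₂ (there (here (_ , v≡)))) = inj₂ (here (open-trail , v≡))
    target (inj₂ (there (there s)))       = inj₂ (there s)

  step : ∀ {ps J} → Decomposition ps J →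
         Saturated ps ⊎ ∃₂ λ qs v → Decomposition qs (v ∷ J)
  step {ps} d with Any.any? (λ P → Any.any? (joinable? P) ps) ps
  ... | no saturated = inj₁ saturated
  ... | yes joinable
    with P , P∈ps , joinableP ← find joinable
    with Q , Q∈ps , joinablePQ ← find joinableP
    with qs , ps↭ ← ∈⇒↭∷ P∈ps
    with Any-resp-↭ ps↭ Q∈ps
  -- `Q` is `P` itself, so the piece is closed; otherwise `Q` is found among the remaining pieces.
  ... | here refl  = inj₂ (_ , _ , proj₂ (closeHead joinablePQ (Decomposition-resp-↭ ps↭ d)))
  ... | there Q∈qs with rs , qs↭ ← ∈⇒↭∷ Q∈qs =
    inj₂ (_ , _ , proj₂ (joinHeads joinablePQ
                          (Decomposition-resp-↭ (↭-trans ps↭ (prep P qs↭)) d)))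

  -- The fuel `m` is 2n minus the length of `J`, which by `balance` is the total weight. At zero
  -- fuel a further joining would make `J` longer than 2n.
  saturate : ∀ m {ps J} → length J + m ≡ n + n → Decomposition ps J →
             ∃₂ λ qs K → Decomposition qs K × Saturated qs
  saturate m {J = J} J+m≡2n d with step d
  ... | inj₁ saturated = _ , _ , d , saturated
  saturate zero    {J = J} J+m≡2n d | inj₂ (qs , v , d′) =
    contradiction (trans (balance d′) (trans (sym J+m≡2n) (+-identityʳ _)))
                  (m+1+n≢m (length J) ∘ trans (+-suc (length J) _))
  saturate (suc m) {J = J} J+m≡2n d | inj₂ (qs , v , d′) =
    saturate m (trans (sym (+-suc (length J) m)) J+m≡2n) d′

  -- If `v` were not in `J`, some open piece would end at `v` and some open piece would start there,
  -- so a joining would still be possible.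
  common-value∈ : ∀ {ps J} → Decomposition ps J → Saturated ps →
                  ∀ {v} → ∃ (λ e → src e ≡ v) → ∃ (λ e → tgt e ≡ v) → v ∈ J
  common-value∈ d saturated (e , refl) (e′ , tgt≡src)
    with sources d e | targets d e′
  ... | inj₁ v∈J | _        = v∈J
  ... | inj₂ _   | inj₁ v∈J = subst (_∈ _) tgt≡src v∈J
  ... | inj₂ s   | inj₂ t   = contradiction
    (Any.map (λ (P-open , v≡end) →
       Any.map (λ (Q-open , v≡start) →
         P-open , Q-open , trans (sym v≡end) (trans tgt≡src v≡start)) s) t)
    saturated

-- Strips of rows

module _ {n : ℕ} (f : Fin n → Fin n → Fin n) where

  open DecMembership {A = Fin n} _≟_ using (_∈?_)

  Inhabited : CyclicMinor f → Set
  Inhabited M = Satisfiable (A M) × Satisfiable (B M)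

  Covers : Fin n → Fin n → CyclicMinor f → Set
  Covers x y M = A M x × B M y

  -- `inhabited` is what makes distinct positions in the list give distinct triples; `within` is
  -- what makes strips over disjoint sets of rows disjoint.
  record Strip (R : Pred (Fin n) 0ℓ) : Set₁ where
    field
      tiles     : List (CyclicMinor f)
      inhabited : All Inhabited tiles
      disjoint  : AllPairs (λ M N → ∀ x y → Covers x y M → ¬ Covers x y N) tiles
      covering  : ∀ {x} → R x → ∀ y → Any (Covers x y) tiles
      within    : All (λ M → ∀ x → A M x → R x) tiles

  open Strip public

  size : ∀ {R} → Strip R → ℕ
  size S = sum (map k (tiles S))

  emptyStrip : ∀ {R} → (∀ {x} → ¬ R x) → Strip R
  emptyStrip ¬R = record
    { tiles     = []
    ; inhabited = []
    ; disjoint  = []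
    ; covering  = λ Rx → contradiction Rx ¬R
    ; within    = []
    }

  mapStrip : ∀ {R S} → (∀ {x} → R x → S x) → (∀ {x} → S x → R x) → Strip R → Strip S
  mapStrip R⇒S S⇒R T = record
    { tiles     = tiles T
    ; inhabited = inhabited T
    ; disjoint  = disjoint T
    ; covering  = covering T ∘ S⇒R
    ; within    = All.map (λ A⇒R x Ax → R⇒S (A⇒R x Ax)) (within T)
    }

  module _ {R S : Pred (Fin n) 0ℓ} (R⇒¬S : ∀ {x} → R x → ¬ S x) where

    stack : Strip R → Strip S → Strip (R ∪ S)
    stack T U = record
      { tiles     = tiles T ++ tiles U
      ; inhabited = All.++⁺ (inhabited T) (inhabited U)
      ; disjoint  = AllPairs.++⁺ (disjoint T) (disjoint U)
          (All.map (λ A⇒R → All.map (λ A⇒S x _ (Ax , _) (A′x , _) → R⇒¬S (A⇒R x Ax) (A⇒S x A′x))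
                                    (within U))
                   (within T))
      ; covering  = [ (λ Rx y → Any.++⁺ˡ (covering T Rx y))
                    , (λ Sx y → Any.++⁺ʳ (tiles T) (covering U Sx y)) ]′
      ; within    = All.++⁺ (All.map (λ A⇒R x Ax → inj₁ (A⇒R x Ax)) (within T))
                            (All.map (λ A⇒S x Ax → inj₂ (A⇒S x Ax)) (within U))
      }

    size-stack : ∀ T U → size (stack T U) ≡ size T + size U
    size-stack T U = trans (cong sum (map-++ k (tiles T) (tiles U)))
                           (sum-++ (map k (tiles T)) (map k (tiles U)))

  -- One row, cut into sets of constancy

  module _ (x : Fin n) where

    occurs? : Decidable (λ v → ∃ λ y → f x y ≡ v)
    occurs? v = any? λ y → f x y ≟ v

    -- Filtering all candidate values, instead of mapping over the columns, lists each value once;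
    -- this makes the tiles disjoint and counts distinct values.
    values : List (Fin n)
    values = filter occurs? (allFin n)

    constantTile : Fin n → CyclicMinor f
    constantTile v = record
      { A      = _≡ x
      ; B      = λ y → f x y ≡ v
      ; A?     = _≟ x
      ; B?     = λ y → f x y ≟ v
      ; k      = 1
      ; cyclic = (λ _ → zero) , (λ _ → zero) , (λ _ → v) , λ { (_ , refl) (_ , fxy≡v) → fxy≡v }
      }

    rowStrip : Strip (_≡ x)
    rowStrip = record
      { tiles     = map constantTile values
      ; inhabited = All.map⁺ (All.map (λ occ → (x , refl) , occ)
                                    (All.all-filter occurs? (allFin n)))
      ; disjoint  = AllPairs.map⁺ (AllPairs.map
          (λ v≢w _ _ (_ , fxy≡v) (_ , fxy≡w) → v≢w (trans (sym fxy≡v) fxy≡w))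
          (Unique.filter⁺ occurs? (Unique.allFin⁺ n)))
      ; covering  = λ { refl y → Any.map⁺ (lose (∈-filter⁺ occurs? (∈-allFin (f x y)) (y , refl))
                                                (refl , refl)) }
      ; within    = All.map⁺ (All.universal (λ _ _ Ax → Ax) values)
      }

    size-rowStrip : size rowStrip ≡ length values
    size-rowStrip = trans (cong sum (sym (map-∘ values)))
                   (trans (sum-map-const _ (λ _ → refl) values) (*-identityʳ _))

    size-rowStrip≤n : size rowStrip ≤ n
    size-rowStrip≤n = begin
      size rowStrip     ≡⟨ size-rowStrip ⟩
      length values     ≤⟨ length-filter occurs? (allFin n) ⟩
      length (allFin n) ≡⟨ length-tabulate {n = n} id ⟩
      n                 ∎
      where open ≤-Reasoning

  -- Two rows, cut along trails or into sets of constancy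

  module _ (x y : Fin n) where

    open Trails (f x) (f y)

    -- The hypothesis on vertex says that reducing positions mod m respects the
    -- trail; for a closed trail with m = length es this identifies its ends.
    trail-cyclic : ∀ {u v es} → Trail u es v → (m : ℕ) .{{_ : NonZero m}} →
                   (∀ i → i ≤ length es → vertex es v (i % m) ≡ vertex es v i) →
                   IsCyclic m (restrict f ((_≡ x) ∪ (_≡ y)) (_∈ es))
    trail-cyclic {v = v} {es} t m wraps = σA , σB , vertex es v ∘ toℕ , correct
      where
      row : ∀ {z} → z ≡ x ⊎ z ≡ y → ℕ
      row (inj₁ _) = 0
      row (inj₂ _) = 1

      -- A closed trail with a single edge has modulus 1, so even the row label 1 must be reduced.
      σA : Σ (Fin n) ((_≡ x) ∪ (_≡ y)) → Fin m
      σA (_ , z∈) = row z∈ mod m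

      σB : Σ (Fin n) (_∈ es) → Fin m
      σB (_ , e∈) = toℕ (index e∈) mod m

      toℕ-mod : ∀ i → toℕ (i mod m) ≡ i % m
      toℕ-mod i = toℕ-fromℕ< (m%n<n i m)

      reduce : ∀ i j → i + j ≤ length es →
               vertex es v (toℕ ((toℕ (i mod m) + toℕ (j mod m)) mod m)) ≡ vertex es v (i + j)
      reduce i j i+j≤l = begin
        vertex es v (toℕ ((toℕ (i mod m) + toℕ (j mod m)) mod m))
          ≡⟨ cong (vertex es v) (toℕ-mod _) ⟩
        vertex es v ((toℕ (i mod m) + toℕ (j mod m)) % m)
          ≡⟨ cong₂ (λ a b → vertex es v ((a + b) % m)) (toℕ-mod i) (toℕ-mod j) ⟩
        vertex es v ((i % m + j % m) % m)
          ≡⟨ cong (vertex es v) (%-distribˡ-+ i j m) ⟨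
        vertex es v ((i + j) % m)
          ≡⟨ wraps (i + j) i+j≤l ⟩
        vertex es v (i + j) ∎
        where open ≡-Reasoning

      correct : ∀ z e → restrict f ((_≡ x) ∪ (_≡ y)) (_∈ es) z e ≡
                        vertex es v (toℕ ((toℕ (σA z) + toℕ (σB e)) mod m))
      correct (_ , inj₁ refl) (_ , e∈) =
        trans (src-vertex t e∈) (sym (reduce 0 (toℕ (index e∈)) (<⇒≤ (toℕ<n (index e∈)))))
      -- In row `y` the last edge reaches position `length es`, the one place where a closed trail
      -- wraps around.
      correct (_ , inj₂ refl) (_ , e∈) =
        trans (tgt-vertex t e∈) (sym (reduce 1 (toℕ (index e∈)) (toℕ<n (index e∈))))

    weight-nonZero : ∀ P → NonZero (weight P)
    weight-nonZero P with shape P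
    ... | open-trail     = _
    ... | closed-trail _ = >-nonZero (∈-length (proj₂ (nonempty P)))

    -- For an open trail of l edges the modulus l + 1 exceeds every position, so nothing wraps. For
    -- a closed one the modulus is l, and only position l wraps, to 0, where the vertex is the same.
    piece-cyclic : ∀ P .{{_ : NonZero (weight P)}} →
                   IsCyclic (weight P) (restrict f ((_≡ x) ∪ (_≡ y)) (_∈ edges P))
    piece-cyclic P@record { shape = open-trail } =
      trail-cyclic (trail P) (weight P) λ i i≤l →
        cong (vertex (edges P) (end P)) (m<n⇒m%n≡m (s≤s i≤l))
    piece-cyclic P@record { shape = closed-trail start≡end } =
      trail-cyclic (trail P) (weight P) wraps
      where
      wraps : ∀ i → i ≤ length (edges P) →
              vertex (edges P) (end P) (i % length (edges P)) ≡ vertex (edges P) (end P) i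
      wraps i i≤l with m≤n⇒m<n∨m≡n i≤l
      ... | inj₁ i<l  = cong (vertex (edges P) (end P)) (m<n⇒m%n≡m i<l)
      ... | inj₂ refl = begin
        vertex (edges P) (end P) (i % i)              ≡⟨ cong (vertex (edges P) (end P)) (n%n≡0 i) ⟩
        vertex (edges P) (end P) 0                    ≡⟨ vertex-start (trail P) ⟩
        start P                                       ≡⟨ start≡end ⟩
        end P                                         ≡⟨ vertex-end (edges P) (end P) ⟨
        vertex (edges P) (end P) (length (edges P))   ∎
        where open ≡-Reasoning

    pieceTile : Piece → CyclicMinor f
    pieceTile P = record
      { A       = (_≡ x) ∪ (_≡ y)
      ; B       = _∈ edges P
      ; A?      = λ z → (z ≟ x) ⊎-dec (z ≟ y)
      ; B?      = _∈? edges P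
      ; k       = weight P
      ; nonZero = weight-nonZero P
      ; cyclic  = piece-cyclic P {{weight-nonZero P}}
      }

    trailStrip : ∀ {ps J} → Decomposition ps J → Strip ((_≡ x) ∪ (_≡ y))
    trailStrip {ps} d = record
      { tiles     = map pieceTile ps
      ; inhabited = All.map⁺ (All.universal (λ P → (x , inj₁ refl) , nonempty P) ps)
      ; disjoint  = AllPairs.map⁺ (AllPairs.map (λ dis _ _ (_ , e∈P) (_ , e∈Q) → dis (e∈P , e∈Q))
                                                (Trails.disjoint d))
      ; covering  = λ z∈ e → Any.map⁺ (Any.map (z∈ ,_) (Trails.covering d e))
      ; within    = All.map⁺ (All.universal (λ _ _ Az → Az) ps)
      }

    size-trailStrip : ∀ {ps J} (d : Decomposition ps J) → size (trailStrip d) ≡ sum (map weight ps)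
    size-trailStrip {ps} d = cong sum (sym (map-∘ ps))

    -- The two candidate strips `T` and `R` together cost at most 3n, so twice the cheaper one does
    -- too; the factor 2 avoids halves.
    pairStrip : x ≢ y → Σ (Strip ((_≡ x) ∪ (_≡ y))) λ S → 2 * size S ≤ 3 * n
    pairStrip x≢y with ps , J , d , saturated ← saturate (n + n) refl singles =
      [ (λ T≤R → T , ≤-trans (m≤n⇒2m≤m+n T≤R) T+R≤3n)
      , (λ R≤T → R , ≤-trans (m≤n⇒2m≤m+n R≤T)
                             (≤-trans (≤-reflexive (+-comm (size R) (size T))) T+R≤3n))
      ]′ (≤-total (size T) (size R))
      where
      separate : ∀ {z} → z ≡ x → z ≢ y
      separate refl = x≢y

      T R : Strip ((_≡ x) ∪ (_≡ y))
      T = trailStrip d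
      R = stack separate (rowStrip x) (rowStrip y)

      m≤n⇒2m≤m+n : ∀ {i j} → i ≤ j → 2 * i ≤ i + j
      m≤n⇒2m≤m+n {i} {j} i≤j = +-monoʳ-≤ i (≤-trans (≤-reflexive (+-identityʳ i)) i≤j)

      length-common≤ : length (filter (_∈? J) (allFin n)) ≤ length J
      length-common≤ = unique-⊆⇒length≤ (Unique.filter⁺ (_∈? J) (Unique.allFin⁺ n))
                                        (proj₂ ∘ ∈-filter⁻ (_∈? J) {xs = allFin n})

      regroup : ∀ w m j → w + (m + j) ≡ m + (j + w)
      regroup = solve-∀

      triple : ∀ m → m + (m + m) ≡ 3 * m
      triple = solve-∀

      W : ℕ
      W = sum (map weight ps)

      T+R≤3n : size T + size R ≤ 3 * n
      T+R≤3n = begin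
        size T + size R
          ≡⟨ cong₂ _+_ (size-trailStrip d) (size-stack separate (rowStrip x) (rowStrip y)) ⟩
        W + (size (rowStrip x) + size (rowStrip y))
          ≡⟨ cong (W +_) (cong₂ _+_ (size-rowStrip x) (size-rowStrip y)) ⟩
        W + (length (values x) + length (values y))
          -- A value counted in both rows is both a source and a target, hence lies in `J`.
          ≤⟨ +-monoʳ-≤ W (length-filter-+ (occurs? x) (occurs? y) (_∈? J)
                           (common-value∈ d saturated) (allFin n)) ⟩
        W + (length (allFin n) + length (filter (_∈? J) (allFin n)))
          ≤⟨ +-monoʳ-≤ W (+-mono-≤ (≤-reflexive (length-tabulate {n = n} id)) length-common≤) ⟩
        W + (n + length J)
          ≡⟨ regroup W n (length J) ⟩
        n + (length J + W)
          ≡⟨ cong (n +_) (balance d) ⟩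
        n + (n + n)
          ≡⟨ triple n ⟩
        3 * n ∎
        where open ≤-Reasoning

  -- The number `l` of rows is separate from the number `n` of columns, so that induction can remove
  -- two rows at a time. Costs are scaled by 4.
  Bounds : ℕ → ℕ → Set
  Bounds l c = (2 ∣ l → 4 * c ≤ 3 * (l * n)) × (2 ∤ l → 4 * c ≤ 3 * (l * n) + n)

  rowsStrip : ∀ xs → Unique xs → Σ (Strip (_∈ xs)) λ S → Bounds (length xs) (size S)
  rowsStrip []       _ = emptyStrip (λ ()) , (λ _ → z≤n) , λ _ → z≤n
  -- The left-over row costs at most n, that is 3n/4 plus the n/4 allowed in the odd case.
  rowsStrip (x ∷ []) _ =
    mapStrip here (λ { (here z≡x) → z≡x }) (rowStrip x)
    , (λ 2∣1 → contradiction (∣1⇒≡1 2∣1) λ ())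
    , λ _ → ≤-trans (*-monoʳ-≤ 4 (size-rowStrip≤n x)) (≤-reflexive (split n))
    where
    split : ∀ m → 4 * m ≡ 3 * (1 * m) + m
    split = solve-∀
  rowsStrip (x ∷ y ∷ xs) ((x≢y ∷ x∉xs) ∷ y∉xs ∷ xs!)
    with S , 2S≤3n ← pairStrip x y x≢y | T , even , odd ← rowsStrip xs xs! =
    mapStrip (λ { (inj₁ (inj₁ z≡x)) → here z≡x
                ; (inj₁ (inj₂ z≡y)) → there (here z≡y)
                ; (inj₂ z∈xs)       → there (there z∈xs) })
             (λ { (here z≡x)           → inj₁ (inj₁ z≡x)
                ; (there (here z≡y))   → inj₁ (inj₂ z≡y)
                ; (there (there z∈xs)) → inj₂ z∈xs })
             (stack separate S T)
    -- Removing two rows keeps the parity, so both bounds follow from `extend`, with surplus 0 in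
    -- the even case and n in the odd one.
    , (λ 2∣ → ≤-trans (extend 0 (≤-trans (even (∣m+n∣m⇒∣n 2∣ ∣-refl)) (m≤m+n _ 0)))
                      (≤-reflexive (+-identityʳ _)))
    , λ 2∤ → extend n (odd (2∤ ∘ ∣m∣n⇒∣m+n ∣-refl))
    where
    separate : ∀ {z} → z ≡ x ⊎ z ≡ y → ¬ z ∈ xs
    separate (inj₁ refl) z∈xs = All.lookup x∉xs z∈xs refl
    separate (inj₂ refl) z∈xs = All.lookup y∉xs z∈xs refl

    expand : ∀ s t → 4 * (s + t) ≡ 2 * (2 * s) + 4 * t
    expand = solve-∀

    collect : ∀ m l c → 2 * (3 * m) + (3 * (l * m) + c) ≡ 3 * ((2 + l) * m) + c
    collect = solve-∀

    extend : ∀ c → 4 * size T ≤ 3 * (length xs * n) + c →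
             4 * size (stack separate S T) ≤ 3 * ((2 + length xs) * n) + c
    extend c 4T≤ = begin
      4 * size (stack separate S T)               ≡⟨ cong (4 *_) (size-stack separate S T) ⟩
      4 * (size S + size T)                       ≡⟨ expand (size S) (size T) ⟩
      2 * (2 * size S) + 4 * size T               ≤⟨ +-mono-≤ (*-monoʳ-≤ 2 2S≤3n) 4T≤ ⟩
      2 * (3 * n) + (3 * (length xs * n) + c)     ≡⟨ collect n (length xs) c ⟩
      3 * ((2 + length xs) * n) + c               ∎
      where open ≤-Reasoning

-- Transport along an enumeration

module _ {ℓ : Level} {D : Set ℓ} {n : ℕ} (D↔Fin : D ↔ Fin n) (f : D → D → D) where

  open Inverse D↔Fin using (to; from; strictlyInverseˡ; strictlyInverseʳ)

  transported : Fin n → Fin n → Fin n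
  transported i j = to (f (from i) (from j))

  pullback : CyclicMinor transported → CyclicMinor f
  pullback M = record
    { A      = A M ∘ to
    ; B      = B M ∘ to
    ; A?     = A? M ∘ to
    ; B?     = B? M ∘ to
    ; k      = k M
    ; cyclic = pulled (CyclicMinor.cyclic M)
    }
    where
    instance _ = CyclicMinor.nonZero M
    pulled : IsCyclic (k M) (restrict transported (A M) (B M)) →
             IsCyclic (k M) (restrict f (A M ∘ to) (B M ∘ to))
    pulled (σA , σB , σC , eq) =
      (λ (x , Ax) → σA (to x , Ax)) , (λ (y , By) → σB (to y , By)) , from ∘ σC ,
      λ (x , Ax) (y , By) → trans
        -- The round trips through `Fin n` cancel on both arguments and on the value of `f`.
        (sym (trans (strictlyInverseʳ _) (cong₂ f (strictlyInverseʳ x) (strictlyInverseʳ y))))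
        (cong from (eq (to x , Ax) (to y , By)))

  stripPartition : ∀ {R} (S : Strip transported R) → (∀ i → R i) → CyclicPartition f
  stripPartition S total = record
    { m         = length (tiles S)
    ; minor     = pullback ∘ tile
    -- A cell of tile `i` also lies in tile `j` when the triples agree, and a shared cell forces
    -- equal indices. The agreement concerns subsets of `D`, so the cell is carried over by `from`
    -- and back by `to`.
    ; distinct  = λ i j (A≐ , B≐ , _) →
        let ((x , Ax) , (y , By)) = All.lookup (inhabited S) (∈-lookup i)
        in coincide i j (Ax , By)
             ( subst (A (tile j)) (strictlyInverseˡ x)
                 (proj₁ A≐ (subst (A (tile i)) (sym (strictlyInverseˡ x)) Ax))
             , subst (B (tile j)) (strictlyInverseˡ y)
                 (proj₁ B≐ (subst (B (tile i)) (sym (strictlyInverseˡ y)) By)))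
    ; partition = λ x y →
        let xy∈ = covering S (total (to x)) (to y)
        in index xy∈ , Any.lookup-index xy∈ , λ {j} → coincide (index xy∈) j (Any.lookup-index xy∈)
    }
    where
    tile : Fin (length (tiles S)) → CyclicMinor transported
    tile = lookup (tiles S)

    coincide : ∀ i j {x y} → Covers transported x y (tile i) →
               Covers transported x y (tile j) → i ≡ j
    coincide i j ∈i ∈j with i ≟ j
    ... | yes i≡j = i≡j
    ... | no  i≢j = contradiction ∈j
      (AllPairs-lookup (λ dis x y ∈N ∈M → dis x y ∈M ∈N) (disjoint S) i j i≢j _ _ ∈i)

  cost-stripPartition : ∀ {R} (S : Strip transported R) (total : ∀ i → R i) →
                        cost (stripPartition S total) ≡ size transported S
  cost-stripPartition S total = ∑-lookup k (tiles S)

lemma1p3 : {ℓ : Level} (D : Set ℓ) (n : ℕ) → D ↔ Fin n →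
    (f : D → D → D) →
    Σ (CyclicPartition f) λ P →
    (2 ∣ n → 4 * cost P ≤ 3 * n ^ 2) ×
    (2 ∤ n → 4 * cost P ≤ 3 * n ^ 2 + n)
lemma1p3 D n D↔Fin f
  with S , bounds ← rowsStrip (transported D↔Fin f) (allFin n) (Unique.allFin⁺ n) =
  stripPartition D↔Fin f S ∈-allFin ,
  square (length-tabulate id) (cost-stripPartition D↔Fin f S ∈-allFin) bounds
  where
  -- The quantities are variables here so that the equations can be matched with `refl`; `n ^ 2`
  -- unfolds to `n * (n * 1)`, whence the rewriting.
  square : ∀ {l c c′} → l ≡ n → c′ ≡ c → Bounds (transported D↔Fin f) l c →
           (2 ∣ n → 4 * c′ ≤ 3 * n ^ 2) × (2 ∤ n → 4 * c′ ≤ 3 * n ^ 2 + n)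
  square refl refl bounds rewrite *-identityʳ n = bounds
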